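{- Let $k,n\in\mathbb{N}$ with $1\le k\le n-1$ and let $G$ be a maximal $k$-degenerate graph of order $n$. If $I$ is a nondecreasing distance-based topological index, then \[ I(G)\le I(P_n^k). \] If $I$ is a nonincreasing distance-based topological index, then \[ I(G)\ge I(P_n^k). \]
   Context: All graphs are finite and simple. The order of a graph is its number of vertices. A graph $G$ is $k$-degenerate if every (nonempty) induced subgraph of $G$ contains a vertex of degree at most $k$ (in that subgraph). A $k$-degenerate graph is maximal $k$-degenerate if after adding any edge (between two nonadjacent vertices) it is no longer $k$-degenerate. (It is known that a maximal $k$-degenerate graph of order at least $k+1$ is $k$-connected, hence connected.) $P_n$ is the path on $n$ vertices. The $k$-th power $G^k$ of a graph $G$ is the graph on the same vertex set in which two distinct vertices are adjacent if their distance in $G$ is at most $k$. For a connected graph $G$, $d_G(u,v)$ is the usual shortest-path distance. The distance sequence $\mathcal{D}(G)$ of a connected graph $G$ is the nondecreasing sequence (of length $\binom{n}{2}$ if $G$ has order $n$) of the distances between all unordered pairs of distinct vertices of $G$, with repetitions. A topological index $I$, assigning a real number to each connected graph, is distance-based if it can be expressed in the form $I(G)=g(\mathcal{D}(G))$, where $g$ is a real-valued function defined on the set of all finite sequences of positive integers. It is called nondecreasing (nonincreasing) if $g$, when restricted to sequences of any fixed length, is nondecreasing (nonincreasing) in every coordinate. -}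

module Defs where

open import Data.Fin using (Fin; toℕ) renaming (_<_ to _<ᶠ_; _<?_ to _<ᶠ?_)
import Data.Fin.Properties as Fin
open import Data.Fin.Subset using (Subset; Nonempty; _∈_; _∩_; ∣_∣)
open import Data.Irrelevant using ([_])
open import Data.List using (List; allFin; cartesianProduct; map; mapMaybe)
import Data.List.Sort as Sort
import Data.Maybe as Maybe
open import Data.Nat using (ℕ; zero; suc; _≤_; z≤n; s≤s; NonZero; ≢-nonZero)
import Data.Nat as ℕ
import Data.Nat.Properties as ℕ
open import Data.Product using (Σ-syntax; ∃; ∃-syntax; _×_; _,_; proj₁; proj₂)
open import Data.Rational using (ℚ) renaming (_<_ to _<ℚ_)
open import Data.Refinement using (value; _,_; Refinement-syntax)
open import Data.Sum using (_⊎_; inj₁; inj₂)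
import Data.Sum as Sum
open import Data.Vec using (Vec; lookup; tabulate; toList; _[_]≔_)
open import Function using (_∘_; _⇔_)
open import Level using (0ℓ)
open import Relation.Binary using (Rel; Decidable; DecTotalOrder; Irreflexive; Symmetric)
import Relation.Binary.Construct.On as On
open import Relation.Binary.PropositionalEquality using (_≡_; _≢_; refl; sym; subst)
open import Relation.Nullary using (¬_; yes; no; does; contradiction; ¬?; _×-dec_; _⊎-dec_)
open import Relation.Nullary.Decidable using (map′; dec⇒maybe)
open import Relation.Unary using (Pred) renaming (_∈_ to _∈ᵖ_; Decidable to Decidable₁)

-- Two-sided Dedekind cuts. Distance-based indices only use the order
-- on the reals, so no arithmetic is needed.

record ℝ : Set₁ where
  field
    lower upper     : Pred ℚ 0ℓ
    lower-inhabited : ∃ lower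
    upper-inhabited : ∃ upper
    lower-rounded   : ∀ q → q ∈ᵖ lower ⇔ (∃[ r ] q <ℚ r × r ∈ᵖ lower)
    upper-rounded   : ∀ q → q ∈ᵖ upper ⇔ (∃[ r ] r <ℚ q × r ∈ᵖ upper)
    disjoint        : ∀ q → ¬ (q ∈ᵖ lower × q ∈ᵖ upper)
    located         : ∀ q r → q <ℚ r → q ∈ᵖ lower ⊎ r ∈ᵖ upper

open ℝ

infix 4 _≤ᴿ_ _≈ᴿ_ _≤⁺_

_≤ᴿ_ : Rel ℝ 0ℓ
x ≤ᴿ y = ∀ q → q ∈ᵖ lower x → q ∈ᵖ lower y

_≈ᴿ_ : Rel ℝ 0ℓ
x ≈ᴿ y = x ≤ᴿ y × y ≤ᴿ x

ℕ⁺ : Set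
ℕ⁺ = [ m ∈ ℕ ∣ NonZero m ]

≤⁺-decTotalOrder : DecTotalOrder 0ℓ 0ℓ 0ℓ
≤⁺-decTotalOrder = On.decTotalOrder ℕ.≤-decTotalOrder (value {P = NonZero})

_≤⁺_ : Rel ℕ⁺ 0ℓ
_≤⁺_ = DecTotalOrder._≤_ ≤⁺-decTotalOrder

least : ∀ {P : Pred ℕ 0ℓ} → Decidable₁ P → ∃ P →
        ∃[ m ] P m × (∀ j → P j → m ≤ j)
least {P} P? (m , pm) = search P? m pm
  where
  search : ∀ {Q : Pred ℕ 0ℓ} → Decidable₁ Q → ∀ m → Q m →
           ∃[ l ] Q l × (∀ j → Q j → l ≤ j)
  search Q? zero    q = zero , q , λ _ _ → z≤n
  search Q? (suc m) q with Q? zero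
  ... | yes q₀ = zero , q₀ , λ _ _ → z≤n
  ... | no ¬q₀ with search (Q? ∘ suc) m q
  ...   | l , ql , l-min = suc l , ql ,
          λ { zero q₀ → contradiction q₀ ¬q₀ ; (suc j) qj → s≤s (l-min j qj) }

record Graph (n : ℕ) : Set₁ where
  field
    Adj    : Rel (Fin n) 0ℓ
    adj?   : Decidable Adj
    symm   : Symmetric Adj
    irrefl : Irreflexive _≡_ Adj

open Graph

module _ {n} (G : Graph n) where

  neighbours : Fin n → Subset n
  neighbours v = tabulate (λ w → does (adj? G v w))

  -- For v ∈ S, the degree of v in the subgraph induced by S.
  degreeIn : Subset n → Fin n → ℕ
  degreeIn S v = ∣ neighbours v ∩ S ∣

  Degenerate : ℕ → Set
  Degenerate k = ∀ (S : Subset n) → Nonempty S → ∃[ v ] v ∈ S × degreeIn S v ≤ k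

  addEdge : ∀ u v → u ≢ v → Graph n
  addEdge u v u≢v = record
    { Adj    = λ x y → Adj G x y ⊎ (x ≡ u × y ≡ v) ⊎ (x ≡ v × y ≡ u)
    ; adj?   = λ x y → adj? G x y
                 ⊎-dec (x Fin.≟ u ×-dec y Fin.≟ v)
                 ⊎-dec (x Fin.≟ v ×-dec y Fin.≟ u)
    ; symm   = λ { (inj₁ a)               → inj₁ (symm G a)
                 ; (inj₂ (inj₁ (p , q))) → inj₂ (inj₂ (q , p))
                 ; (inj₂ (inj₂ (p , q))) → inj₂ (inj₁ (q , p)) }
    ; irrefl = λ { x≡y  (inj₁ a)                    → irrefl G x≡y a
                 ; refl (inj₂ (inj₁ (refl , u≡v))) → u≢v u≡v
                 ; refl (inj₂ (inj₂ (refl , v≡u))) → u≢v (sym v≡u) }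
    }

  data Walk : ℕ → Rel (Fin n) 0ℓ where
    []  : ∀ {u} → Walk 0 u u
    _∷_ : ∀ {ℓ u v w} → Adj G u v → Walk ℓ v w → Walk (suc ℓ) u w

  walk? : ∀ ℓ → Decidable (Walk ℓ)
  walk? zero    u v = map′ (λ { refl → [] }) (λ { [] → refl }) (u Fin.≟ v)
  walk? (suc ℓ) u v =
    map′ (λ { (_ , a , p) → a ∷ p }) (λ { (a ∷ p) → _ , a , p })
         (Fin.any? (λ w → adj? G u w ×-dec walk? ℓ w v))

  snoc : ∀ {ℓ u v w} → Walk ℓ u v → Adj G v w → Walk (suc ℓ) u w
  snoc []      a = a ∷ []
  snoc (b ∷ p) a = b ∷ snoc p a

  reverse : ∀ {ℓ u v} → Walk ℓ u v → Walk ℓ v u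
  reverse []      = []
  reverse (a ∷ p) = snoc (reverse p) (symm G a)

  -- d is the distance between u and v; no such d exists for u and v in
  -- different components.
  IsDistance : Fin n → Fin n → ℕ → Set
  IsDistance u v d = Walk d u v × (∀ ℓ → Walk ℓ u v → d ≤ ℓ)

  DistanceAtMost : ℕ → Rel (Fin n) 0ℓ
  DistanceAtMost k u v = ∃[ d ] IsDistance u v d × d ≤ k

  distanceAtMost? : ∀ k → Decidable (DistanceAtMost k)
  distanceAtMost? k u v =
    map′ (λ { (ℓ , s≤s ℓ≤k , p) →
              let d , q , d-min = least (λ m → walk? m u v) (ℓ , p)
              in d , (q , d-min) , ℕ.≤-trans (d-min ℓ p) ℓ≤k })
         (λ { (d , (p , _) , d≤k) → d , s≤s d≤k , p })
         (ℕ.anyUpTo? (λ m → walk? m u v) (suc k))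

  power : ℕ → Graph n
  power k = record
    { Adj    = λ u v → u ≢ v × DistanceAtMost k u v
    ; adj?   = λ u v → ¬? (u Fin.≟ v) ×-dec distanceAtMost? k u v
    ; symm   = λ { (u≢v , d , (p , d-min) , d≤k) →
                   u≢v ∘ sym , d ,
                   (reverse p , λ ℓ q → d-min ℓ (reverse q)) , d≤k }
    ; irrefl = λ u≡v (u≢v , _) → u≢v u≡v
    }

  Connected : Set
  Connected = ∀ u v → ∃[ ℓ ] Walk ℓ u v

MaximalDegenerate : ∀ {n} → ℕ → Graph n → Set
MaximalDegenerate k G =
  Degenerate G k ×
  (∀ u v (u≢v : u ≢ v) → ¬ Adj G u v → ¬ Degenerate (addEdge G u v u≢v) k)

P : ∀ n → Graph n
P n = record
  { Adj    = λ i j → suc (toℕ i) ≡ toℕ j ⊎ suc (toℕ j) ≡ toℕ i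
  ; adj?   = λ i j → (suc (toℕ i) ℕ.≟ toℕ j) ⊎-dec (suc (toℕ j) ℕ.≟ toℕ i)
  ; symm   = Sum.swap
  ; irrefl = λ { refl (inj₁ e) → ℕ.1+n≢n e ; refl (inj₂ e) → ℕ.1+n≢n e }
  }

record ConnectedGraph : Set₁ where
  constructor mkConnected
  field
    {order}   : ℕ
    graph     : Graph order
    connected : Connected graph

module _ (C : ConnectedGraph) where
  open ConnectedGraph C

  distance : Fin order → Fin order → ℕ
  distance u v = proj₁ (least (λ ℓ → walk? graph ℓ u v) (connected u v))

  distance-isDistance : ∀ u v → IsDistance graph u v (distance u v)
  distance-isDistance u v = proj₂ (least (λ ℓ → walk? graph ℓ u v) (connected u v))

  distance≢0 : ∀ {u v} → u ≢ v → distance u v ≢ 0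
  distance≢0 {u} {v} u≢v d≡0
    with [] ← subst (λ d → Walk graph d u v) d≡0 (proj₁ (distance-isDistance u v))
    = u≢v refl

  distance⁺ : ∀ u v → u <ᶠ v → ℕ⁺
  distance⁺ u v u<v = distance u v , [ ≢-nonZero (distance≢0 (Fin.<⇒≢ u<v)) ]

  -- Each unordered pair {u , v} is represented once, with u < v.
  pairDistances : List ℕ⁺
  pairDistances =
    mapMaybe (λ (u , v) → Maybe.map (distance⁺ u v) (dec⇒maybe (u <ᶠ? v)))
             (cartesianProduct (allFin order) (allFin order))

  distanceSequence : List ℕ⁺
  distanceSequence = Sort.sort ≤⁺-decTotalOrder pairDistances

TopologicalIndex : Set₁
TopologicalIndex = ConnectedGraph → ℝ

Expresses : (List ℕ⁺ → ℝ) → TopologicalIndex → Set₁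
Expresses g I = ∀ C → I C ≈ᴿ g (distanceSequence C)

DistanceBased : TopologicalIndex → Set₁
DistanceBased I = ∃[ g ] Expresses g I

NondecreasingInEachCoordinate : (List ℕ⁺ → ℝ) → Set
NondecreasingInEachCoordinate g =
  ∀ m (xs : Vec ℕ⁺ m) i y → lookup xs i ≤⁺ y →
  g (toList xs) ≤ᴿ g (toList (xs [ i ]≔ y))

NonincreasingInEachCoordinate : (List ℕ⁺ → ℝ) → Set
NonincreasingInEachCoordinate g =
  ∀ m (xs : Vec ℕ⁺ m) i y → lookup xs i ≤⁺ y →
  g (toList (xs [ i ]≔ y)) ≤ᴿ g (toList xs)

NondecreasingDistanceBased : TopologicalIndex → Set₁
NondecreasingDistanceBased I =
  Σ[ (g , _) ∈ DistanceBased I ] NondecreasingInEachCoordinate g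

NonincreasingDistanceBased : TopologicalIndex → Set₁
NonincreasingDistanceBased I =
  Σ[ (g , _) ∈ DistanceBased I ] NonincreasingInEachCoordinate g

{-# OPTIONS --safe #-}
module Submission where

-- A maximal k-degenerate graph has an elimination order v_n, …, v_1 in which
-- each v_j has at least k neighbours among the earlier vertices v_1, …, v_{j-1}
-- or is adjacent to all of them: otherwise an edge at v_j could be added without
-- destroying the order. Induction along the order shows that in G[v_1, …, v_j]
-- a closed neighbourhood of A has at least |A| + k vertices or is everything,
-- so v_j has at least min (j - 1, t k) earlier vertices within distance t. In
-- P_n^k the j-th vertex has at most that many. Summing over j, for every t the
-- graph G has at least as many pairs at distance at most t as P_n^k, so its
-- sorted distance sequence is termwise at most that of P_n^k, and g can be
-- compared by changing one coordinate at a time.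

open import Defs
open import Data.Nat using
  (ℕ; zero; suc; _+_; _*_; _⊓_; _∸_; _≤_; _<_; _≤?_; z≤n; s≤s; s≤s⁻¹; >-nonZero)
open import Data.Nat.Properties
open import Data.Fin using (Fin; zero; suc; toℕ)
import Data.Fin as Fin
import Data.Fin.Properties as Fin
open import Data.Fin.Subset using
  (Subset; inside; outside; _∈_; _∉_; _⊆_; Nonempty; Empty; ∣_∣; _∩_; _-_; ⊤)
open import Data.Fin.Subset.Properties
open import Data.Bool using (true; false)
open import Data.Product using (Σ-syntax; ∃; ∃-syntax; _×_; _,_; proj₁; proj₂)
open import Data.Sum using (_⊎_; inj₁; inj₂; [_,_]′)
open import Data.List using (List; []; _∷_; _++_; length; map; filter; allFin; cartesianProduct; mapMaybe)
open import Data.List.Properties using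
  (filter-++; filter-all; filter-none; filter-accept; filter-reject; length-filter; length-++; length-map;
   mapMaybe-++; map-mapMaybe)
open import Data.List.Relation.Binary.Permutation.Propositional using (_↭_)
import Data.List.Relation.Binary.Permutation.Propositional as ↭
open import Data.List.Relation.Binary.Permutation.Propositional.Properties using
  (++⁺; map⁺; shifts; ↭-length; filter-↭)
open import Data.List.Relation.Binary.Sublist.Propositional using () renaming (⊆-refl to sublist-refl)
import Data.List.Relation.Binary.Sublist.Propositional.Properties as Sublist
open import Data.List.Relation.Binary.Pointwise using (Pointwise; []; _∷_)
import Data.List.Relation.Binary.Pointwise as Pointwise
import Data.List.Membership.Propositional as List
open import Data.List.Membership.Propositional.Properties using (∈-filter⁺; ∈-allFin)
open import Data.List.Relation.Unary.Any using (here; there)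
open import Data.List.Relation.Unary.All using (All; []; _∷_)
import Data.List.Relation.Unary.All as All
import Data.List.Relation.Unary.All.Properties as All
open import Data.List.Relation.Unary.AllPairs using (AllPairs; []; _∷_)
import Data.List.Relation.Unary.AllPairs.Properties as AllPairs
open import Data.List.Relation.Unary.Unique.Propositional using (Unique)
open import Data.List.Relation.Unary.Unique.Propositional.Properties using (allFin⁺)
open import Data.List.Relation.Unary.Sorted.TotalOrder.Properties using (Sorted⇒AllPairs)
open import Data.List.Relation.Binary.BagAndSetEquality using (∼bag⇒↭)
open import Data.List.Membership.Propositional.Properties.WithK using (unique∧set⇒bag)
open import Data.List.Sort ≤⁺-decTotalOrder using (sort-↭; sort-↗)
open import Data.Maybe using (Maybe; just; nothing)
import Data.Maybe as Maybe
open import Data.Refinement using (value)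
open import Data.Vec using (Vec; tabulate; []; _∷_; here; there; lookup; toList; fromList; _[_]≔_)
open import Data.Vec.Properties using (lookup∘tabulate; []=⇒lookup; lookup⇒[]=; toList∘fromList)
open import Function using (_∘_; id; flip; case_of_; mk⇔)
open import Relation.Nullary using (¬_; Dec; yes; no; does; contradiction; ¬?; _×-dec_)
open import Relation.Nullary.Decidable using (dec-true; dec⇒maybe; decidable-stable)
open import Relation.Unary using (Decidable)
open import Relation.Binary.PropositionalEquality using
  (_≡_; _≢_; refl; sym; trans; cong; cong₂; subst; module ≡-Reasoning)
open import Relation.Binary using (Rel; DecTotalOrder)
open import Level using (0ℓ)

open Graph

-- Finite subsets and their cardinalities.

does-true : ∀ {a} {A : Set a} (a? : Dec A) → does a? ≡ true → A
does-true (yes a) _ = a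

module _ {n p} {P : Fin n → Set p} (P? : Decidable P) where

  select : Subset n
  select = tabulate (does ∘ P?)

  ∈-select⁺ : ∀ {x} → P x → x ∈ select
  ∈-select⁺ {x} px = lookup⇒[]= x _ (trans (lookup∘tabulate _ x) (dec-true (P? x) px))

  ∈-select⁻ : ∀ {x} → x ∈ select → P x
  ∈-select⁻ {x} x∈ = does-true (P? x) (trans (sym (lookup∘tabulate _ x)) ([]=⇒lookup x∈))

Empty⇒∣p∣≡0 : ∀ {n} {p : Subset n} → Empty p → ∣ p ∣ ≡ 0
Empty⇒∣p∣≡0 {n} p≡∅ = trans (cong ∣_∣ (Empty-unique p≡∅)) (∣⊥∣≡0 n)

p-x⊆p : ∀ {n} (p : Subset n) x → p - x ⊆ p
p-x⊆p p x = p─q⊆p p _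

x∉p-x : ∀ {n} (p : Subset n) x → x ∉ p - x
x∉p-x (s ∷ p) (suc x) (there x∈) = x∉p-x p x x∈

y∈p-x∧y∈q⇒y∈q-x : ∀ {n} {p q : Subset n} {x y} → y ∈ p - x → y ∈ q → y ∈ q - x
y∈p-x∧y∈q⇒y∈q-x {p = p} {x = x} y∈p-x y∈q = x∈p∧x≢y⇒x∈p-y y∈q λ { refl → x∉p-x p x y∈p-x }

p⊆q∧x∉p⇒p⊆q-x : ∀ {n} {p q : Subset n} {x} → p ⊆ q → x ∉ p → p ⊆ q - x
p⊆q∧x∉p⇒p⊆q-x p⊆q x∉p y∈p = x∈p∧x≢y⇒x∈p-y (p⊆q y∈p) λ { refl → x∉p y∈p }

p-x⊆q∧x∈q⇒p⊆q : ∀ {n} {p q : Subset n} {x} → p - x ⊆ q → x ∈ q → p ⊆ q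
p-x⊆q∧x∈q⇒p⊆q {x = x} p-x⊆q x∈q {y} y∈p with y Fin.≟ x
... | yes refl = x∈q
... | no  y≢x  = p-x⊆q (x∈p∧x≢y⇒x∈p-y y∈p y≢x)

∣p∣≤1+∣p-x∣ : ∀ {n} (p : Subset n) x → ∣ p ∣ ≤ suc ∣ p - x ∣
∣p∣≤1+∣p-x∣ (inside  ∷ p) zero    = s≤s (≤-reflexive (cong ∣_∣ (sym (p─⊥≡p p))))
∣p∣≤1+∣p-x∣ (outside ∷ p) zero    = m≤n⇒m≤1+n (≤-reflexive (cong ∣_∣ (sym (p─⊥≡p p))))
∣p∣≤1+∣p-x∣ (inside  ∷ p) (suc x) = s≤s (∣p∣≤1+∣p-x∣ p x)
∣p∣≤1+∣p-x∣ (outside ∷ p) (suc x) = ∣p∣≤1+∣p-x∣ p x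

∣p∣+∣q∣≤∣r∣ : ∀ {n} (p q r : Subset n) → p ⊆ r → q ⊆ r →
              (∀ {x} → x ∈ p → x ∉ q) → ∣ p ∣ + ∣ q ∣ ≤ ∣ r ∣
∣p∣+∣q∣≤∣r∣ [] [] [] _ _ _ = z≤n
∣p∣+∣q∣≤∣r∣ (s ∷ p) (t ∷ q) (u ∷ r) p⊆r q⊆r p∩q=∅
  with ∣p∣+∣q∣≤∣r∣ p q r (drop-∷-⊆ p⊆r) (drop-∷-⊆ q⊆r) (λ x∈p x∈q → p∩q=∅ (there x∈p) (there x∈q))
∣p∣+∣q∣≤∣r∣ (outside ∷ p) (outside ∷ q) (u ∷ r) _ _ _ | ih = ≤-trans ih (∣p∣≤∣x∷p∣ u r)
∣p∣+∣q∣≤∣r∣ (inside  ∷ p) (inside  ∷ q) (u ∷ r) _ _ p∩q=∅ | ih = contradiction here (p∩q=∅ here)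
∣p∣+∣q∣≤∣r∣ (inside  ∷ p) (outside ∷ q) (u ∷ r) p⊆r _ _ | ih with here ← p⊆r here = s≤s ih
∣p∣+∣q∣≤∣r∣ (outside ∷ p) (inside  ∷ q) (u ∷ r) _ q⊆r _ | ih with here ← q⊆r here =
  ≤-trans (≤-reflexive (+-suc ∣ p ∣ ∣ q ∣)) (s≤s ih)

∣p∣≤length : ∀ {n} (p : Subset n) (xs : List (Fin n)) →
             (∀ {x} → x ∈ p → x List.∈ xs) → ∣ p ∣ ≤ length xs
∣p∣≤length p [] p⊆[] = ≤-reflexive (Empty⇒∣p∣≡0 empty)
  where
  empty : Empty p
  empty (_ , x∈p) = case p⊆[] x∈p of λ ()
∣p∣≤length p (x ∷ xs) p⊆x∷xs = ≤-trans (∣p∣≤1+∣p-x∣ p x) (s≤s (∣p∣≤length (p - x) xs p-x⊆xs))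
  where
  p-x⊆xs : ∀ {y} → y ∈ p - x → y List.∈ xs
  p-x⊆xs y∈ with p⊆x∷xs (p-x⊆p p x y∈)
  ... | here refl  = contradiction y∈ (x∉p-x p x)
  ... | there y∈xs = y∈xs

-- Degrees under restriction and under adding an edge.

-- Adjacency is compared only inside `T`, so edges of `H` that leave `T` do not count. This is how
-- an added edge is ignored once one of its ends has been removed.
degreeIn-mono : ∀ {n} {G H : Graph n} {S T x} → T ⊆ S →
                (∀ {y} → y ∈ T → Adj H x y → Adj G x y) → degreeIn H T x ≤ degreeIn G S x
degreeIn-mono {G = G} {H} {S} {T} {x} T⊆S H⊆G = p⊆q⇒∣p∣≤∣q∣ λ y∈ →
  let y∈N , y∈T = x∈p∩q⁻ (neighbours H x) T y∈
  in x∈p∩q⁺ (∈-select⁺ (adj? G x) (H⊆G y∈T (∈-select⁻ (adj? H x) y∈N)) , T⊆S y∈T)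

degreeIn-addEdge : ∀ {n} (G : Graph n) {u v} (u≢v : u ≢ v) S →
                   degreeIn (addEdge G u v u≢v) S v ≤ suc (degreeIn G S v)
degreeIn-addEdge G {u} {v} u≢v S =
  ≤-trans (∣p∣≤1+∣p-x∣ (neighbours G′ v ∩ S) u) (s≤s (p⊆q⇒∣p∣≤∣q∣ old))
  where
  G′ = addEdge G u v u≢v

  old : neighbours G′ v ∩ S - u ⊆ neighbours G v ∩ S
  old y∈ with x∈p∩q⁻ (neighbours G′ v) S (p-x⊆p _ u y∈)
  ... | y∈N , y∈S with ∈-select⁻ (adj? G′ v) y∈N
  ...   | inj₁ a                  = x∈p∩q⁺ (∈-select⁺ (adj? G v) a , y∈S)
  ...   | inj₂ (inj₁ (v≡u , _))   = contradiction (sym v≡u) u≢v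
  ...   | inj₂ (inj₂ (_ , refl)) = contradiction y∈ (x∉p-x _ u)

-- Elimination orders.

-- The head of the list is removed first, and `Step` sees the set still present, `v` included.
-- Abstracting `Step` lets one type serve both for degeneracy orders (`Light`) and for the orders
-- that maximality forces (`Attached`).
data Elimination {n} (Step : Subset n → Fin n → Set) : Subset n → List (Fin n) → Set where
  []  : ∀ {S} → Empty S → Elimination Step S []
  _∷_ : ∀ {S v vs} → v ∈ S × Step S v → Elimination Step (S - v) vs → Elimination Step S (v ∷ vs)

module _ {n} {Step : Subset n → Fin n → Set} where

  elimination-map : ∀ {Step′ : Subset n → Fin n → Set} {S vs} →
                    (∀ {T x} → T ⊆ S → x ∈ T → Step T x → Step′ T x) →
                    Elimination Step S vs → Elimination Step′ S vs
  elimination-map f ([] e)            = [] e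
  elimination-map {S = S} f (_∷_ {v = v} (v∈S , s) e) =
    (v∈S , f id v∈S s) ∷ elimination-map (λ T⊆ → f λ x∈ → p-x⊆p S v (T⊆ x∈)) e

  elimination-∈⁺ : ∀ {S vs x} → Elimination Step S vs → x ∈ S → x List.∈ vs
  elimination-∈⁺ ([] e) x∈S = contradiction (_ , x∈S) e
  elimination-∈⁺ {x = x} (_∷_ {v = v} _ e) x∈S with x Fin.≟ v
  ... | yes x≡v = here x≡v
  ... | no  x≢v = there (elimination-∈⁺ e (x∈p∧x≢y⇒x∈p-y x∈S x≢v))

  elimination-∈⁻ : ∀ {S vs x} → Elimination Step S vs → x List.∈ vs → x ∈ S
  elimination-∈⁻ ((v∈S , _) ∷ e) (here refl)  = v∈S
  elimination-∈⁻ {S = S} (_ ∷ e)     (there x∈) = p-x⊆p S _ (elimination-∈⁻ e x∈)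

  elimination-unique : ∀ {S vs} → Elimination Step S vs → Unique vs
  elimination-unique ([] _) = []
  elimination-unique {S = S} (_∷_ {v = v} _ e) =
    All.tabulate (λ { x∈vs refl → x∉p-x S v (elimination-∈⁻ e x∈vs) }) ∷ elimination-unique e

module _ {n} (G : Graph n) (k : ℕ) where

  Light : Subset n → Fin n → Set
  Light S v = degreeIn G S v ≤ k

  -- The second alternative caters for the end of the order: when at most `k` vertices remain, no
  -- degree reaches `k`.
  Attached : Subset n → Fin n → Set
  Attached S v = k ≤ degreeIn G S v ⊎ (∀ {u} → u ∈ S → u ≢ v → Adj G v u)

  degenerate⇒elimination : Degenerate G k → ∃ (Elimination Light ⊤)
  degenerate⇒elimination deg = build n ⊤ (≤-reflexive (∣⊤∣≡n n))
    where
    build : ∀ m S → ∣ S ∣ ≤ m → ∃ (Elimination Light S)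
    -- Vertices of small degree are removed greedily; `m` bounds the size of what remains and drives
    -- the recursion.
    build m S ∣S∣≤m with nonempty? S
    ... | no  S≡∅ = [] , [] S≡∅
    ... | yes S≢∅ with deg S S≢∅
    build zero    S ∣S∣≤0 | yes _ | v , v∈S , _ =
      contradiction (<-≤-trans (x∈p⇒∣p-x∣<∣p∣ v∈S) ∣S∣≤0) λ ()
    build (suc m) S ∣S∣≤m | yes _ | v , v∈S , light =
      let vs , e = build m (S - v) (s≤s⁻¹ (<-≤-trans (x∈p⇒∣p-x∣<∣p∣ v∈S) ∣S∣≤m))
      in v ∷ vs , (v∈S , light) ∷ e

  -- When the first vertex of the order that lies in `T` is removed, all of `T` is still present, so
  -- its degree in `T` is at most its degree at that moment.
  elimination⇒degenerate : ∀ {vs} → Elimination Light ⊤ vs → Degenerate G k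
  elimination⇒degenerate e T = find e ⊆⊤
    where
    find : ∀ {S vs} → Elimination Light S vs → T ⊆ S → Nonempty T → ∃[ v ] v ∈ T × Light T v
    find ([] S≡∅) T⊆S (_ , x∈T) = contradiction (_ , T⊆S x∈T) S≡∅
    find (_∷_ {v = v} (_ , light) e) T⊆S T≢∅ with v ∈? T
    ... | yes v∈T = v , v∈T , ≤-trans (degreeIn-mono {G = G} {G} T⊆S (λ _ → id)) light
    ... | no  v∉T = find e (λ x∈T → x∈p∧x≢y⇒x∈p-y (T⊆S x∈T) λ { refl → v∉T x∈T }) T≢∅

-- Maximality forces attached orders.

-- The same list must remain a degeneracy order after the edge is added. Both ends lie in `S`, so
-- vertices removed earlier are not touched by the edge.
AddableEdge : ∀ {n} → Graph n → ℕ → Subset n → List (Fin n) → Set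
AddableEdge G k S vs =
  ∃[ u ] ∃[ v ] Σ[ u≢v ∈ u ≢ v ] u ∈ S × v ∈ S × ¬ Adj G u v ×
  Elimination (Light (addEdge G u v u≢v) k) S vs

-- If the head `v` has degree below `k` and misses some `u` in `S`, joining them raises its degree
-- to at most `k`; later degrees do not change because `v` is gone by then.
attached-or-addable : ∀ {n} (G : Graph n) k {S vs} → Elimination (Light G k) S vs →
                      Elimination (Attached G k) S vs ⊎ AddableEdge G k S vs
attached-or-addable G k ([] e) = inj₁ ([] e)
attached-or-addable {n} G k {S} {v ∷ vs} ((v∈S , light) ∷ e) =
  case k ≤? degreeIn G S v of λ where
    (yes heavy) → extend (inj₁ heavy)
    (no ¬heavy) → case Fin.any? (λ u → (u ∈? S) ×-dec ¬? (u Fin.≟ v) ×-dec ¬? (adj? G u v)) of λ where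
      (yes (u , u∈S , u≢v , ¬uv)) → inj₂ (u , v , u≢v , u∈S , v∈S , ¬uv ,
        (v∈S , ≤-trans (degreeIn-addEdge G u≢v S) (≰⇒> ¬heavy)) ∷
        elimination-map (λ T⊆ x∈T → ≤-trans (degreeIn-mono {G = G} {addEdge G u v u≢v} id λ where
          y∈T (inj₁ a)                 → a
          y∈T (inj₂ (inj₁ (_ , refl))) → contradiction (T⊆ y∈T) (x∉p-x S v)
          y∈T (inj₂ (inj₂ (refl , _))) → contradiction (T⊆ x∈T) (x∉p-x S v))) e)
      (no full) → extend (inj₂ λ {u} u∈S u≢v → symm G
        (decidable-stable (adj? G u v) λ ¬uv → full (u , u∈S , u≢v , ¬uv)))
  where
  extend : Attached G k S v → Elimination (Attached G k) S (v ∷ vs) ⊎ AddableEdge G k S (v ∷ vs)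
  extend attached = case attached-or-addable G k e of λ where
    (inj₁ e′) → inj₁ ((v∈S , attached) ∷ e′)
    (inj₂ (u , w , u≢w , u∈ , w∈ , ¬uw , e′)) →
      inj₂ (u , w , u≢w , p-x⊆p S v u∈ , p-x⊆p S v w∈ , ¬uw ,
        -- Both ends of the new edge lie in `S - v`, so the degree of `v` stays the same.
        (v∈S , ≤-trans (degreeIn-mono {G = G} {addEdge G u w u≢w} id λ where
          _ (inj₁ a)                 → a
          _ (inj₂ (inj₁ (refl , _))) → contradiction u∈ (x∉p-x S v)
          _ (inj₂ (inj₂ (refl , _))) → contradiction w∈ (x∉p-x S v)) light) ∷ e′)

maximal⇒attached : ∀ {n} (G : Graph n) k → MaximalDegenerate k G → ∃ (Elimination (Attached G k) ⊤)
maximal⇒attached G k (deg , maximal) =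
  let vs , e = degenerate⇒elimination G k deg
  in case attached-or-addable G k e of λ where
       (inj₁ e′) → vs , e′
       (inj₂ (u , v , u≢v , _ , _ , ¬uv , e′)) →
         contradiction (elimination⇒degenerate (addEdge G u v u≢v) k e′) (maximal u v u≢v ¬uv)

-- Expansion along an attached order.

neighbours∩⁻ : ∀ {n} (G : Graph n) {S v u} → u ∈ neighbours G v ∩ S → Adj G v u × u ∈ S - v
neighbours∩⁻ G {S} {v} u∈ =
  let u∈N , u∈S = x∈p∩q⁻ (neighbours G v) S u∈
      vu = ∈-select⁻ (adj? G v) u∈N
  in vu , x∈p∧x≢y⇒x∈p-y u∈S λ u≡v → irrefl G (sym u≡v) vu

-- k-connectedness of G[S]: B contains the closed neighbourhood of A in S, so
-- B ─ A separates A from S ─ B.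
attached⇒expanding : ∀ {n} (G : Graph n) k {S vs} → Elimination (Attached G k) S vs →
                     ∀ A B → A ⊆ S → A ⊆ B → Nonempty A →
                     (∀ {a u} → a ∈ A → u ∈ S → Adj G a u → u ∈ B) →
                     S ⊆ B ⊎ ∣ A ∣ + k ≤ ∣ B ∣
attached⇒expanding G k ([] S≡∅) A B A⊆S _ (_ , x∈A) _ = contradiction (_ , A⊆S x∈A) S≡∅
attached⇒expanding G k {S} (_∷_ {v = v} (v∈S , attached) e) A B A⊆S A⊆B A≢∅@(a , a∈A) closed
  with v ∈? A
... | no v∉A
    with attached⇒expanding G k e A (B - v) (p⊆q∧x∉p⇒p⊆q-x A⊆S v∉A) (p⊆q∧x∉p⇒p⊆q-x A⊆B v∉A) A≢∅
           (λ x∈A u∈ xu → y∈p-x∧y∈q⇒y∈q-x u∈ (closed x∈A (p-x⊆p S v u∈) xu))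
...   | inj₂ large = inj₂ (≤-trans large (p⊆q⇒∣p∣≤∣q∣ (p-x⊆p B v)))
...   | inj₁ S-v⊆B-v with v ∈? B | attached
...     | yes v∈B | _          = inj₁ (p-x⊆q∧x∈q⇒p⊆q (λ u∈ → p-x⊆p B v (S-v⊆B-v u∈)) v∈B)
-- As `v ∉ B`, no neighbour of `v` lies in the nonempty set `A`, so `v` cannot be adjacent to all of
-- `S`.
...     | no  v∉B | inj₂ full  =
  contradiction (closed a∈A v∈S (symm G (full (A⊆S a∈A) λ { refl → v∉A a∈A }))) v∉B
-- The neighbours of `v` in `S`, at least `k` of them, lie in `S - v` and hence in `B`, and they
-- avoid `A`.
...     | no  v∉B | inj₁ heavy = inj₂ (≤-trans (+-monoʳ-≤ ∣ A ∣ heavy) (∣p∣+∣q∣≤∣r∣ A _ B A⊆B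
  (λ u∈ → p-x⊆p B v (S-v⊆B-v (proj₂ (neighbours∩⁻ G u∈))))
  (λ u∈A u∈ → v∉B (closed u∈A v∈S (symm G (proj₁ (neighbours∩⁻ G u∈)))))))
attached⇒expanding G k {S} (_∷_ {v = v} (v∈S , attached) e) A B A⊆S A⊆B A≢∅@(a , a∈A) closed
    | yes v∈A with nonempty? (A - v)
... | no A-v≡∅ with attached
...   | inj₁ heavy = inj₂ (≤-trans (+-mono-≤ ∣A∣≤1 heavy) (≤-trans
  (s≤s (p⊆q⇒∣p∣≤∣q∣ λ u∈ → let vu , u∈S-v = neighbours∩⁻ G u∈
                           in y∈p-x∧y∈q⇒y∈q-x u∈S-v (closed v∈A (p-x⊆p S v u∈S-v) vu)))
  (x∈p⇒∣p-x∣<∣p∣ (A⊆B v∈A))))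
  where
  ∣A∣≤1 : ∣ A ∣ ≤ 1
  ∣A∣≤1 = ≤-trans (∣p∣≤1+∣p-x∣ A v)
    (s≤s (≤-reflexive (Empty⇒∣p∣≡0 A-v≡∅)))
...   | inj₂ full  = inj₁ (p-x⊆q∧x∈q⇒p⊆q
  (λ u∈ → closed v∈A (p-x⊆p S v u∈) (full (p-x⊆p S v u∈) λ { refl → x∉p-x S v u∈ })) (A⊆B v∈A))
attached⇒expanding G k {S} (_∷_ {v = v} (v∈S , attached) e) A B A⊆S A⊆B A≢∅@(a , a∈A) closed
    | yes v∈A | yes A-v≢∅
    with attached⇒expanding G k e (A - v) (B - v)
           (λ x∈ → y∈p-x∧y∈q⇒y∈q-x x∈ (A⊆S (p-x⊆p A v x∈)))
           (λ x∈ → y∈p-x∧y∈q⇒y∈q-x x∈ (A⊆B (p-x⊆p A v x∈)))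
           A-v≢∅
           (λ x∈ u∈ xu → y∈p-x∧y∈q⇒y∈q-x u∈ (closed (p-x⊆p A v x∈) (p-x⊆p S v u∈) xu))
... | inj₁ S-v⊆B-v = inj₁ (p-x⊆q∧x∈q⇒p⊆q (λ u∈ → p-x⊆p B v (S-v⊆B-v u∈)) (A⊆B v∈A))
-- Putting `v` back adds one to each side of the inductive bound.
... | inj₂ large   = inj₂ (≤-trans (+-monoˡ-≤ k (∣p∣≤1+∣p-x∣ A v))
                            (≤-trans (s≤s large) (x∈p⇒∣p-x∣<∣p∣ (A⊆B v∈A))))

-- Balls and their growth.

module _ {n} (G : Graph n) where

  walk⇒DistanceAtMost : ∀ {t ℓ u v} → Walk G ℓ u v → ℓ ≤ t → DistanceAtMost G t u v
  walk⇒DistanceAtMost {ℓ = ℓ} p ℓ≤t =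
    let d , q , d-min = least (λ m → walk? G m _ _) (ℓ , p)
    in d , (q , d-min) , ≤-trans (d-min ℓ p) ℓ≤t

  ball : ℕ → Fin n → Subset n
  ball t v = select (distanceAtMost? G t v)

  ∈-ball⁻ : ∀ {t v u} → u ∈ ball t v → DistanceAtMost G t v u
  ∈-ball⁻ {t} {v} = ∈-select⁻ (distanceAtMost? G t v)

  walk⇒∈-ball : ∀ {t ℓ v u} → Walk G ℓ v u → ℓ ≤ t → u ∈ ball t v
  walk⇒∈-ball {t} {v = v} p ℓ≤t = ∈-select⁺ (distanceAtMost? G t v) (walk⇒DistanceAtMost p ℓ≤t)

  ball-step : ∀ {t v a u} → a ∈ ball t v → Adj G a u → u ∈ ball (suc t) v
  ball-step a∈ au = let _ , (p , _) , d≤t = ∈-ball⁻ a∈ in walk⇒∈-ball (snoc G p au) (s≤s d≤t)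

  ball-mono : ∀ {t v} → ball t v ⊆ ball (suc t) v
  ball-mono u∈ = let _ , (p , _) , d≤t = ∈-ball⁻ u∈ in walk⇒∈-ball p (m≤n⇒m≤1+n d≤t)

  -- Expansion is applied to the parts in `S` of the balls of radius `t` and `t + 1`, so each unit
  -- of radius gains `k` vertices. The balls are taken in `G`, whose distances are to be counted.
  -- The `suc` stands for the centre, which is the whole bound at radius 0.
  ball-growth : ∀ k {S vs v} → Elimination (Attached G k) S vs → v ∈ S → ∀ t →
                S ⊆ ball t v ⊎ suc (t * k) ≤ ∣ ball t v ∩ S ∣
  ball-growth k {S} {v = v} e v∈S = grow
    where
    v∈ball∩S : ∀ t → v ∈ ball t v ∩ S
    v∈ball∩S t = x∈p∩q⁺ (walk⇒∈-ball {t} [] z≤n , v∈S)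
    grow : ∀ t → S ⊆ ball t v ⊎ suc (t * k) ≤ ∣ ball t v ∩ S ∣
    grow zero = inj₂ (≤-trans (s≤s z≤n) (x∈p⇒∣p-x∣<∣p∣ (v∈ball∩S 0)))
    grow (suc t) with grow t
    ... | inj₁ S⊆ball = inj₁ (λ u∈S → ball-mono (S⊆ball u∈S))
    ... | inj₂ large
        with attached⇒expanding G k e (ball t v ∩ S) (ball (suc t) v ∩ S)
               (p∩q⊆q _ S)
               (λ u∈ → let u∈ball , u∈S = x∈p∩q⁻ _ S u∈ in x∈p∩q⁺ (ball-mono u∈ball , u∈S))
               (v , v∈ball∩S t)
               (λ a∈ u∈S au → x∈p∩q⁺ (ball-step (proj₁ (x∈p∩q⁻ _ S a∈)) au , u∈S))
    ...   | inj₁ S⊆ball  = inj₁ (λ u∈S → proj₁ (x∈p∩q⁻ _ S (S⊆ball u∈S)))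
    ...   | inj₂ larger = inj₂ (≤-trans (≤-reflexive (cong suc (+-comm k (t * k))))
                                (≤-trans (+-monoˡ-≤ k large) larger))

  -- The ball of radius `n` must be everything, since the other alternative gives it at least
  -- `1 + n * k > n` vertices.
  attached⇒connected : ∀ k {vs} → 1 ≤ k → Elimination (Attached G k) ⊤ vs → Connected G
  attached⇒connected k 1≤k e u v with ball-growth k e (∈⊤ {x = u}) n
  ... | inj₁ ⊤⊆ball = let d , (p , _) , _ = ∈-ball⁻ {n} (⊤⊆ball {v} ∈⊤) in d , p
  ... | inj₂ large  = contradiction (∣p∣≤n (ball n u ∩ ⊤))
                        (<⇒≱ (≤-trans (s≤s (m≤m*n n k {{>-nonZero 1≤k}})) large))

-- Counting entries up to a threshold, and lists indexed by pairs.

count : ℕ → List ℕ → ℕ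
count t xs = length (filter (_≤? t) xs)

pairs : ∀ {a b} {A : Set a} {B : Set b} → (A → A → B) → List A → List B
pairs f []       = []
pairs f (x ∷ xs) = map (f x) xs ++ pairs f xs

-- Swapping two adjacent entries replaces `f x y` by `f y x` and exchanges two blocks. This allows
-- pairs to be listed along the elimination order instead of `allFin`.
pairs-↭ : ∀ {a b} {A : Set a} {B : Set b} {f : A → A → B} → (∀ x y → f x y ≡ f y x) →
          ∀ {xs ys} → xs ↭ ys → pairs f xs ↭ pairs f ys
pairs-↭ f-sym ↭.refl = ↭.refl
pairs-↭ {f = f} f-sym (↭.prep x xs↭ys) = ++⁺ (map⁺ (f x) xs↭ys) (pairs-↭ f-sym xs↭ys)
pairs-↭ {f = f} f-sym {_ ∷ _ ∷ xs} (↭.swap x y xs↭ys) rewrite f-sym y x =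
  ↭.prep (f x y) (↭.trans (shifts (map (f x) xs) (map (f y) xs))
    (++⁺ (map⁺ (f y) xs↭ys) (++⁺ (map⁺ (f x) xs↭ys) (pairs-↭ f-sym xs↭ys))))
pairs-↭ f-sym (↭.trans p q) = ↭.trans (pairs-↭ f-sym p) (pairs-↭ f-sym q)

count-++ : ∀ t xs ys → count t (xs ++ ys) ≡ count t xs + count t ys
count-++ t xs ys = trans (cong length (filter-++ (_≤? t) xs ys)) (length-++ (filter (_≤? t) xs))

count-↭ : ∀ t {xs ys} → xs ↭ ys → count t xs ≡ count t ys
count-↭ t xs↭ys = ↭-length (filter-↭ (_≤? t) xs↭ys)

count-all : ∀ {t xs} → All (_≤ t) xs → count t xs ≡ length xs
count-all = cong length ∘ filter-all (_≤? _)

count-none : ∀ {t xs} → All (t <_) xs → count t xs ≡ 0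
count-none = cong length ∘ filter-none (_≤? _) ∘ All.map <⇒≱

count-map : ∀ {a} {A : Set a} t (f : A → ℕ) xs → count t (map f xs) ≡ length (filter (λ x → f x ≤? t) xs)
count-map t f []       = refl
count-map t f (x ∷ xs) with does (f x ≤? t)
... | true  = cong suc (count-map t f xs)
... | false = count-map t f xs

1≤count⇒head≤ : ∀ {x xs t} → All (x ≤_) xs → 1 ≤ count t (x ∷ xs) → x ≤ t
1≤count⇒head≤ {x} {t = t} x≤xs 1≤ = ≮⇒≥ λ t<x →
  contradiction (count-none (t<x ∷ All.map (<-≤-trans t<x) x≤xs)) (<⇒≢ 1≤ ∘ sym)

count-∷-≤ : ∀ {x t} xs → x ≤ t → count t (x ∷ xs) ≡ suc (count t xs)
count-∷-≤ xs x≤t = cong length (filter-accept (_≤? _) x≤t)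

-- Domination at `t = y` compares the heads. For the tails, if `y ≤ t` both heads are counted and
-- cancel; if `t < y` no entry of `ys` is counted.
count-dominated⇒pointwise : ∀ {xs ys} → AllPairs _≤_ xs → AllPairs _≤_ ys → length xs ≡ length ys →
                            (∀ t → count t ys ≤ count t xs) → Pointwise _≤_ xs ys
count-dominated⇒pointwise [] [] _ _ = []
count-dominated⇒pointwise {x ∷ xs} {y ∷ ys} (x≤xs ∷ xs↗) (y≤ys ∷ ys↗) eq dom =
  x≤y ∷ count-dominated⇒pointwise xs↗ ys↗ (suc-injective eq) dom-tail
  where
  x≤y : x ≤ y
  x≤y = 1≤count⇒head≤ x≤xs (≤-trans (≤-trans (s≤s z≤n) (≤-reflexive (sym (count-∷-≤ {y} ys ≤-refl)))) (dom y))
  dom-tail : ∀ t → count t ys ≤ count t xs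
  dom-tail t with y ≤? t
  ... | yes y≤t = s≤s⁻¹ (≤-trans (≤-reflexive (sym (count-∷-≤ ys y≤t)))
                    (≤-trans (dom t) (≤-reflexive (count-∷-≤ xs (≤-trans x≤y y≤t)))))
  ... | no  y≰t = ≤-trans (≤-reflexive (count-none (All.map (<-≤-trans (≰⇒> y≰t)) y≤ys))) z≤n

-- cappedSum (t * k) n is the number of pairs at distance at most t in P_n^k.
cappedSum : ℕ → ℕ → ℕ
cappedSum c zero    = 0
cappedSum c (suc m) = m ⊓ c + cappedSum c m

-- Lower bound for the number of close pairs in `G`.

∈-ball⇒distance≤ : ∀ {n} {G : Graph n} (c : Connected G) {t u v} →
                   v ∈ ball G t u → distance (mkConnected G c) u v ≤ t
∈-ball⇒distance≤ {G = G} c v∈ =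
  let d , (p , _) , d≤t = ∈-ball⁻ G v∈
  in ≤-trans (proj₂ (distance-isDistance (mkConnected G c) _ _) d p) d≤t

-- The row of `v` runs over the vertices left after its removal; by `ball-growth` all of them, or at
-- least `t * k`, are within distance `t`.
cappedSum≤count-pairs : ∀ {n} {G : Graph n} (c : Connected G) k t {S vs} →
                        Elimination (Attached G k) S vs →
                        cappedSum (t * k) (length vs) ≤ count t (pairs (distance (mkConnected G c)) vs)
cappedSum≤count-pairs c k t ([] _) = z≤n
cappedSum≤count-pairs {G = G} c k t {S} {v ∷ vs} e₀@((v∈S , _) ∷ e) =
  ≤-trans (+-mono-≤ near (cappedSum≤count-pairs c k t e))
    (≤-reflexive (sym (count-++ t (map (d v) vs) (pairs d vs))))
  where
  d = distance (mkConnected G c)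

  listed : ∀ {u} → u ∈ ball G t v ∩ S - v → u List.∈ filter (λ u → d v u ≤? t) vs
  listed u∈ =
    let u∈ball , u∈S = x∈p∩q⁻ (ball G t v) S (p-x⊆p _ v u∈)
    in ∈-filter⁺ (λ u → d v u ≤? t) (elimination-∈⁺ e (y∈p-x∧y∈q⇒y∈q-x u∈ u∈S))
         (∈-ball⇒distance≤ c u∈ball)

  near : length vs ⊓ (t * k) ≤ count t (map (d v) vs)
  near with ball-growth G k e₀ v∈S t
  ... | inj₁ S⊆ball = ≤-trans (m⊓n≤m _ (t * k)) (≤-reflexive (sym (trans
          (count-all (All.map⁺ (All.tabulate λ u∈vs →
            ∈-ball⇒distance≤ c (S⊆ball (p-x⊆p S v (elimination-∈⁻ e u∈vs))))))
          (length-map (d v) vs))))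
  ... | inj₂ large  = ≤-trans (m⊓n≤n (length vs) _) (≤-trans
          -- Removing the centre `v` from its ball cancels the `suc` in `suc (t * k)`.
          (s≤s⁻¹ (≤-trans large (∣p∣≤1+∣p-x∣ (ball G t v ∩ S) v)))
          (≤-trans (∣p∣≤length (ball G t v ∩ S - v) _ listed) (≤-reflexive (sym (count-map t (d v) vs)))))

-- Upper bound for the number of close pairs in the power of the path.

count-interval : ∀ c x {xs} → All (x <_) xs → AllPairs _<_ xs → count (x + c) xs ≤ c
count-interval c x [] [] = z≤n
count-interval c x {y ∷ ys} (x<y ∷ x<ys) (y<ys ∷ ys↗) with y ≤? x + c
count-interval c       x (x<y ∷ x<ys) (y<ys ∷ ys↗) | no y≰x+c =
  ≤-trans (≤-reflexive (cong length (filter-reject (_≤? x + c) y≰x+c))) (count-interval c x x<ys ys↗)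
count-interval zero    x (x<y ∷ x<ys) (y<ys ∷ ys↗) | yes y≤x =
  contradiction (≤-trans y≤x (≤-reflexive (+-identityʳ x))) (<⇒≱ x<y)
count-interval (suc c) x {y ∷ ys} (x<y ∷ x<ys) (y<ys ∷ ys↗) | yes y≤x+c
  rewrite filter-accept (_≤? x + suc c) {x = y} {xs = ys} y≤x+c | +-suc x c =
  -- The tail lies above `suc x`, so the interval loses its lowest integer and keeps its top.
  s≤s (count-interval c (suc x) (All.map (≤-<-trans x<y) y<ys) ys↗)

module _ {n} (d : Fin n → Fin n → ℕ) {t c} (d≤t⇒close : ∀ u v → d u v ≤ t → toℕ v ≤ toℕ u + c) where

  -- Later vertices within distance `t` of `v` are among the `c` integers following `v`; near the
  -- end of the list fewer may remain, whence the minimum.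
  count-pairs≤cappedSum : ∀ {vs} → AllPairs Fin._<_ vs → count t (pairs d vs) ≤ cappedSum c (length vs)
  count-pairs≤cappedSum [] = z≤n
  count-pairs≤cappedSum {v ∷ vs} (v<vs ∷ vs↗) =
    ≤-trans (≤-reflexive (count-++ t (map (d v) vs) (pairs d vs)))
      (+-mono-≤ (⊓-glb all-bound interval-bound) (count-pairs≤cappedSum vs↗))
    where
    all-bound : count t (map (d v) vs) ≤ length vs
    all-bound = ≤-trans (length-filter (_≤? t) (map (d v) vs)) (≤-reflexive (length-map (d v) vs))

    interval-bound : count t (map (d v) vs) ≤ c
    interval-bound = begin
      count t (map (d v) vs)                           ≡⟨ count-map t (d v) vs ⟩
      length (filter (λ u → d v u ≤? t) vs)            ≤⟨ Sublist.length-mono-≤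
        (Sublist.filter⁺ (λ u → d v u ≤? t) (λ u → toℕ u ≤? toℕ v + c)
          (λ { {u} refl → d≤t⇒close v u }) (sublist-refl {x = vs})) ⟩
      length (filter (λ u → toℕ u ≤? toℕ v + c) vs)    ≡⟨ count-map (toℕ v + c) toℕ vs ⟨
      count (toℕ v + c) (map toℕ vs)                   ≤⟨ count-interval c (toℕ v) (All.map⁺ v<vs) (AllPairs.map⁺ vs↗) ⟩
      c ∎
      where open ≤-Reasoning

-- Used twice: with `c = 1` on `P n`, to bound how far an edge of the power reaches, and then with
-- `c = k` on the power itself.
walk-length-bound : ∀ {n} (G : Graph n) c → (∀ {u v} → Adj G u v → toℕ v ≤ toℕ u + c) →
                    ∀ {ℓ u v} → Walk G ℓ u v → toℕ v ≤ toℕ u + ℓ * c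
walk-length-bound G c step []      = m≤m+n _ 0
walk-length-bound G c step {suc ℓ} {u} {v} (_∷_ {v = w} a p) = begin
  toℕ v               ≤⟨ walk-length-bound G c step p ⟩
  toℕ w + ℓ * c       ≤⟨ +-monoˡ-≤ (ℓ * c) (step a) ⟩
  toℕ u + c + ℓ * c   ≡⟨ +-assoc (toℕ u) c (ℓ * c) ⟩
  toℕ u + (c + ℓ * c) ∎
  where open ≤-Reasoning

path-step : ∀ {n} {u v : Fin n} → Adj (P n) u v → toℕ v ≤ toℕ u + 1
path-step {u = u} {v} (inj₁ 1+u≡v) = ≤-reflexive (trans (sym 1+u≡v) (+-comm 1 (toℕ u)))
path-step {u = u} {v} (inj₂ 1+v≡u) = ≤-trans (n≤1+n (toℕ v)) (≤-trans (≤-reflexive 1+v≡u) (m≤m+n (toℕ u) 1))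

power-path-step : ∀ {n k} {u v : Fin n} → Adj (power (P n) k) u v → toℕ v ≤ toℕ u + k
power-path-step {n} {k} {u} (_ , d , (p , _) , d≤k) =
  ≤-trans (walk-length-bound (P n) 1 path-step p)
    (+-monoʳ-≤ (toℕ u) (≤-trans (≤-reflexive (*-identityʳ d)) d≤k))

power-path-connected : ∀ n k → 1 ≤ k → Connected (power (P n) k)
power-path-connected n k 1≤k u v = [ rightward , (λ v≤u → let ℓ , p = rightward v≤u in ℓ , reverse G p) ]′
                                     (≤-total (toℕ u) (toℕ v))
  where
  G = power (P n) k

  adjacent : ∀ {u v} → suc (toℕ u) ≡ toℕ v → Adj G u v
  adjacent {u} 1+u≡v = (λ { refl → 1+n≢n 1+u≡v }) , walk⇒DistanceAtMost (P n) (inj₁ 1+u≡v ∷ []) 1≤k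

  climb : ∀ m {u v} → toℕ v ≡ m + toℕ u → Walk G m u v
  climb zero    v≡u   = subst (Walk G 0 _) (Fin.toℕ-injective (sym v≡u)) []
  climb (suc m) {u} {v} v≡1+m+u = adjacent (sym w≡1+u) ∷ climb m v≡m+w
    where
    1+u<n : suc (toℕ u) < n
    1+u<n = ≤-<-trans (≤-trans (s≤s (m≤n+m (toℕ u) m)) (≤-reflexive (sym v≡1+m+u))) (Fin.toℕ<n v)
    w≡1+u : toℕ (Fin.fromℕ< 1+u<n) ≡ suc (toℕ u)
    w≡1+u = Fin.toℕ-fromℕ< 1+u<n
    v≡m+w : toℕ v ≡ m + toℕ (Fin.fromℕ< 1+u<n)
    v≡m+w = trans v≡1+m+u (trans (sym (+-suc m (toℕ u))) (cong (m +_) (sym w≡1+u)))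

  rightward : ∀ {u v} → toℕ u ≤ toℕ v → ∃[ ℓ ] Walk G ℓ u v
  rightward {u} {v} u≤v = toℕ v ∸ toℕ u , climb _ (sym (m∸n+n≡m u≤v))

-- Distance sequences as sorted lists over pairs.

module _ {n} (f : Fin n × Fin n → Maybe ℕ) (h : Fin n → Fin n → ℕ)
         (f-< : ∀ {u v} → u Fin.< v → f (u , v) ≡ just (h u v))
         (f-≮ : ∀ {u v} → ¬ u Fin.< v → f (u , v) ≡ nothing) where

  mapMaybe-row : ∀ {u vs} → All (u Fin.<_) vs → mapMaybe f (map (u ,_) vs) ≡ map (h u) vs
  mapMaybe-row []           = refl
  mapMaybe-row (u<v ∷ u<vs) rewrite f-< u<v = cong (_ ∷_) (mapMaybe-row u<vs)

  mapMaybe-column : ∀ {us v vs} → All (v Fin.<_) us →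
                    mapMaybe f (cartesianProduct us (v ∷ vs)) ≡ mapMaybe f (cartesianProduct us vs)
  mapMaybe-column [] = refl
  mapMaybe-column {u ∷ us} {v} {vs} (v<u ∷ v<us) rewrite f-≮ (<-asym v<u) = begin
    mapMaybe f (map (u ,_) vs ++ cartesianProduct us (v ∷ vs))
      ≡⟨ mapMaybe-++ f (map (u ,_) vs) _ ⟩
    mapMaybe f (map (u ,_) vs) ++ mapMaybe f (cartesianProduct us (v ∷ vs))
      ≡⟨ cong (_ ++_) (mapMaybe-column v<us) ⟩
    mapMaybe f (map (u ,_) vs) ++ mapMaybe f (cartesianProduct us vs)
      ≡⟨ mapMaybe-++ f (map (u ,_) vs) _ ⟨
    mapMaybe f (map (u ,_) vs ++ cartesianProduct us vs) ∎
    where open ≡-Reasoning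

  -- The row of `v` yields the pairs that begin with `v`; the diagonal entry and the column below it
  -- yield `nothing`, which leaves a smaller square.
  mapMaybe-triangle : ∀ {vs} → AllPairs Fin._<_ vs → mapMaybe f (cartesianProduct vs vs) ≡ pairs h vs
  mapMaybe-triangle [] = refl
  mapMaybe-triangle {v ∷ vs} (v<vs ∷ vs↗) rewrite f-≮ (<-irrefl {toℕ v} refl) = begin
    mapMaybe f (map (v ,_) vs ++ cartesianProduct vs (v ∷ vs))
      ≡⟨ mapMaybe-++ f (map (v ,_) vs) _ ⟩
    mapMaybe f (map (v ,_) vs) ++ mapMaybe f (cartesianProduct vs (v ∷ vs))
      ≡⟨ cong₂ _++_ (mapMaybe-row v<vs) (trans (mapMaybe-column v<vs) (mapMaybe-triangle vs↗)) ⟩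
    map (h v) vs ++ pairs h vs ∎
    where open ≡-Reasoning

allFin↗ : ∀ n → AllPairs Fin._<_ (allFin n)
allFin↗ n = AllPairs.tabulate⁺-< id

length-pairs : ∀ {a b} {A : Set a} {B : Set b} (f g : A → A → B) xs → length (pairs f xs) ≡ length (pairs g xs)
length-pairs f g []       = refl
length-pairs f g (x ∷ xs) = begin
  length (map (f x) xs ++ pairs f xs)         ≡⟨ length-++ (map (f x) xs) ⟩
  length (map (f x) xs) + length (pairs f xs)
    ≡⟨ cong₂ _+_ (trans (length-map (f x) xs) (sym (length-map (g x) xs))) (length-pairs f g xs) ⟩
  length (map (g x) xs) + length (pairs g xs) ≡⟨ length-++ (map (g x) xs) ⟨
  length (map (g x) xs ++ pairs g xs)         ∎
  where open ≡-Reasoning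

module _ (C : ConnectedGraph) where
  open ConnectedGraph C

  distance-sym : ∀ u v → distance C u v ≡ distance C v u
  distance-sym u v = ≤-antisym (shorter u v) (shorter v u)
    where
    shorter : ∀ u v → distance C u v ≤ distance C v u
    shorter u v = proj₂ (distance-isDistance C u v) _ (reverse graph (proj₁ (distance-isDistance C v u)))

  pairDistances-values : map value (pairDistances C) ≡ pairs (distance C) (allFin order)
  pairDistances-values = trans (map-mapMaybe value _ (cartesianProduct (allFin order) (allFin order)))
    (mapMaybe-triangle _ (distance C) below not-below (allFin↗ order))
    where
    below : ∀ {u v} → u Fin.< v →
            Maybe.map value (Maybe.map (distance⁺ C u v) (dec⇒maybe (u Fin.<? v))) ≡ just (distance C u v)
    below {u} {v} u<v with u Fin.<? v
    ... | yes _   = refl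
    ... | no u≮v = contradiction u<v u≮v
    not-below : ∀ {u v} → ¬ u Fin.< v →
                Maybe.map value (Maybe.map (distance⁺ C u v) (dec⇒maybe (u Fin.<? v))) ≡ nothing
    not-below {u} {v} u≮v with u Fin.<? v
    ... | yes u<v = contradiction u<v u≮v
    ... | no  _   = refl

  distanceSequence-values : map value (distanceSequence C) ↭ pairs (distance C) (allFin order)
  distanceSequence-values =
    ↭.trans (map⁺ value (sort-↭ (pairDistances C))) (↭.↭-reflexive pairDistances-values)

  distanceSequence↗ : AllPairs _≤_ (map value (distanceSequence C))
  distanceSequence↗ =
    AllPairs.map⁺ (Sorted⇒AllPairs (DecTotalOrder.totalOrder ≤⁺-decTotalOrder) (sort-↗ (pairDistances C)))

-- Sorting only permutes, so counts over pairs are counts in the sorted sequences; these are equally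
-- long because both graphs have order `n`.
distanceSequence-dominated :
  ∀ {n} {G H : Graph n} (c : Connected G) (c′ : Connected H) →
  (∀ t → count t (pairs (distance (mkConnected H c′)) (allFin n)) ≤
         count t (pairs (distance (mkConnected G c)) (allFin n))) →
  Pointwise _≤⁺_ (distanceSequence (mkConnected G c)) (distanceSequence (mkConnected H c′))
distanceSequence-dominated {n} {G} {H} c c′ dom = Pointwise.map⁻ value value
  (count-dominated⇒pointwise (distanceSequence↗ C) (distanceSequence↗ D) same-length dom′)
  where
  C = mkConnected G c
  D = mkConnected H c′

  same-length : length (map value (distanceSequence C)) ≡ length (map value (distanceSequence D))
  same-length = trans (↭-length (distanceSequence-values C))
    (trans (length-pairs (distance C) (distance D) (allFin n)) (sym (↭-length (distanceSequence-values D))))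

  dom′ : ∀ t → count t (map value (distanceSequence D)) ≤ count t (map value (distanceSequence C))
  dom′ t = ≤-trans (≤-reflexive (count-↭ t (distanceSequence-values D)))
    (≤-trans (dom t) (≤-reflexive (sym (count-↭ t (distanceSequence-values C)))))

-- Coordinatewise monotone functions on pointwise ordered lists.

module _ (_≼_ : Rel ℝ 0ℓ) (≼-refl : ∀ x → x ≼ x) (≼-trans : ∀ x y z → x ≼ y → y ≼ z → x ≼ z) where

  -- Taking `_≤ᴿ_` or its flip for `_≼_` gives the nondecreasing or the nonincreasing case, so one
  -- proof covers both.
  Monotone : (List ℕ⁺ → ℝ) → Set
  Monotone g = ∀ m (xs : Vec ℕ⁺ m) i y → lookup xs i ≤⁺ y → g (toList xs) ≼ g (toList (xs [ i ]≔ y))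

  -- The head is raised first; the tail is then handled with `g ∘ (y ∷_)`, which is again monotone
  -- in each coordinate.
  monotone-pointwise : ∀ g → Monotone g → ∀ {xs ys} → Pointwise _≤⁺_ xs ys → g xs ≼ g ys
  monotone-pointwise g mono [] = ≼-refl _
  monotone-pointwise g mono {x ∷ xs} {y ∷ ys} (x≤y ∷ xs≤ys) = ≼-trans _ _ _
    (subst (λ zs → g (x ∷ zs) ≼ g (y ∷ zs)) (toList∘fromList xs) (mono _ (x ∷ fromList xs) zero y x≤y))
    (monotone-pointwise (g ∘ (y ∷_)) (λ m zs i → mono (suc m) (y ∷ zs) (suc i)) xs≤ys)

-- The order on the reals and the comparison of indices.

≤ᴿ-refl : ∀ x → x ≤ᴿ x
≤ᴿ-refl _ q = id

≤ᴿ-trans : ∀ x y z → x ≤ᴿ y → y ≤ᴿ z → x ≤ᴿ z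
≤ᴿ-trans _ _ _ x≤y y≤z q = y≤z q ∘ x≤y q

theorem3 : ∀ (k n : ℕ) → 1 ≤ k → k ≤ n ∸ 1 →
    (G : Graph n) → MaximalDegenerate k G →
    Σ[ c ∈ Connected G ] Σ[ c′ ∈ Connected (power (P n) k) ]
    ((I : TopologicalIndex) →
    (NondecreasingDistanceBased I → I (mkConnected G c) ≤ᴿ I (mkConnected (power (P n) k) c′)) ×
    (NonincreasingDistanceBased I → I (mkConnected (power (P n) k) c′) ≤ᴿ I (mkConnected G c)))
theorem3 k n 1≤k _ G maximal = c , c′ , λ I →
  (λ ((g , I≈g) , mono) → λ q → proj₂ (I≈g D) q ∘
    monotone-pointwise _≤ᴿ_ ≤ᴿ-refl ≤ᴿ-trans g mono dominated q ∘ proj₁ (I≈g C) q) ,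
  (λ ((g , I≈g) , anti) → λ q → proj₂ (I≈g C) q ∘
    monotone-pointwise (flip _≤ᴿ_) ≤ᴿ-refl (λ x y z y≤x z≤y → ≤ᴿ-trans z y x z≤y y≤x) g anti dominated q ∘
    proj₁ (I≈g D) q)
  where
  vs = proj₁ (maximal⇒attached G k maximal)
  order : Elimination (Attached G k) ⊤ vs
  order = proj₂ (maximal⇒attached G k maximal)

  c  = attached⇒connected G k 1≤k order
  c′ = power-path-connected n k 1≤k
  C  = mkConnected G c
  D  = mkConnected (power (P n) k) c′

  order↭allFin : vs ↭ allFin n
  order↭allFin = ∼bag⇒↭ (unique∧set⇒bag (elimination-unique order) (allFin⁺ n)
    (mk⇔ (λ _ → ∈-allFin _) (λ _ → elimination-∈⁺ order ∈⊤)))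

  distance≤⇒close : ∀ t u v → distance D u v ≤ t → toℕ v ≤ toℕ u + t * k
  distance≤⇒close t u v d≤t =
    ≤-trans (walk-length-bound (power (P n) k) k power-path-step (proj₁ (distance-isDistance D u v)))
      (+-monoʳ-≤ (toℕ u) (*-monoˡ-≤ k d≤t))

  dominated : Pointwise _≤⁺_ (distanceSequence C) (distanceSequence D)
  -- `cappedSum` separates the two counts; the last step returns from the elimination order to
  -- `allFin` by symmetry of the distance.
  dominated = distanceSequence-dominated c c′ λ t → begin
    count t (pairs (distance D) (allFin n))   ≤⟨ count-pairs≤cappedSum (distance D) (distance≤⇒close t) (allFin↗ n) ⟩
    cappedSum (t * k) (length (allFin n))     ≡⟨ cong (cappedSum (t * k)) (↭-length order↭allFin) ⟨
    cappedSum (t * k) (length vs)             ≤⟨ cappedSum≤count-pairs c k t order ⟩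
    count t (pairs (distance C) vs)           ≡⟨ count-↭ t (pairs-↭ (distance-sym C) order↭allFin) ⟩
    count t (pairs (distance C) (allFin n))   ∎
    where open ≤-Reasoning
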